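{- The only protoalgebraic extension of $\mathrm{BD}_\infty$ other than the trivial logic $\mathrm{TRIV}$ and the almost trivial logic $\mathrm{TRIV}_-$ is classical logic $\mathrm{CL}_1$.
   Context: Formulas are built from variables using $\wedge,\vee,\neg$. A structure is a pair $\langle\mathbf{A},F\rangle$, $F\subseteq A$; a rule $\Gamma\vdash\varphi$ is valid in it if every homomorphism $v$ from the formula algebra with $v[\Gamma]\subseteq F$ has $v(\varphi)\in F$. A logic is a substitution-invariant consequence relation; an extension of a logic is a logic containing its consequence relation. $\mathrm{BD}_\infty$ is the logic determined by all $\langle\mathbf{A},F\rangle$ with $\mathbf{A}$ a De~Morgan lattice (distributive lattice with $\neg$, $\neg\neg x=x$, De~Morgan laws) and $F$ an upset. $\mathrm{TRIV}$: $\Gamma\vdash\varphi$ always holds; $\mathrm{TRIV}_-$: $\Gamma\vdash\varphi$ holds iff $\Gamma\ne\emptyset$. $\mathrm{CL}_1$ is classical propositional logic, the logic of the two-element Boolean algebra with designated set $\{1\}$. A logic $\mathcal{L}$ is protoalgebraic if there is a set $\Delta(x,y)$ of formulas in two variables with $\emptyset\vdash_{\mathcal{L}}\delta(x,x)$ for each $\delta\in\Delta$ and $x,\Delta(x,y)\vdash_{\mathcal{L}}y$. -}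

module Defs where

open import Level using (Level) renaming (suc to lsuc; zero to lzero)
open import Data.Nat using (ℕ)
open import Data.Bool using (Bool; true; false; _∧_; _∨_; not)
open import Data.Product using (Σ; ∃; _×_; _,_)
open import Data.Sum using (_⊎_)
open import Function.Bundles using (_⇔_)
open import Relation.Binary.PropositionalEquality using (_≡_)
import Algebra.Lattice.Structures as LS

data Fm : Set where
  var  : ℕ → Fm
  _∧ᶠ_ : Fm → Fm → Fm
  _∨ᶠ_ : Fm → Fm → Fm
  ¬ᶠ_  : Fm → Fm

FmSet : Set₁
FmSet = Fm → Set

∅ : FmSet
∅ _ = Data.Empty.⊥ where import Data.Empty

Subst : Set
Subst = ℕ → Fm

_[_] : Fm → Subst → Fm
var n    [ σ ] = σ n
(a ∧ᶠ b) [ σ ] = (a [ σ ]) ∧ᶠ (b [ σ ])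
(a ∨ᶠ b) [ σ ] = (a [ σ ]) ∨ᶠ (b [ σ ])
(¬ᶠ a)   [ σ ] = ¬ᶠ (a [ σ ])

_⟦_⟧ : FmSet → Subst → FmSet
(Γ ⟦ σ ⟧) ψ = Σ Fm (λ γ → Γ γ × (γ [ σ ]) ≡ ψ)

Rel⊢ : Set₂
Rel⊢ = FmSet → Fm → Set₁

record IsLogic (_⊢_ : Rel⊢) : Set₁ where
  field
    reflexive    : ∀ Γ φ → Γ φ → Γ ⊢ φ
    monotone     : ∀ Γ Δ φ → (∀ ψ → Γ ψ → Δ ψ) → Γ ⊢ φ → Δ ⊢ φ
    cut          : ∀ Γ Δ φ → (∀ ψ → Δ ψ → Γ ⊢ ψ) → Δ ⊢ φ → Γ ⊢ φ
    substitution : ∀ Γ φ (σ : Subst) → Γ ⊢ φ → (Γ ⟦ σ ⟧) ⊢ (φ [ σ ])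

record DeMorganLattice : Set₁ where
  field
    Carrier : Set
    _⊓_ _⊔_ : Carrier → Carrier → Carrier
    ∼_      : Carrier → Carrier
    isDistributiveLattice : LS.IsDistributiveLattice (_≡_ {A = Carrier}) _⊔_ _⊓_
    ∼-involutive : ∀ x → ∼ (∼ x) ≡ x
    deMorgan-⊓   : ∀ x y → ∼ (x ⊓ y) ≡ (∼ x) ⊔ (∼ y)
    deMorgan-⊔   : ∀ x y → ∼ (x ⊔ y) ≡ (∼ x) ⊓ (∼ y)

  _≤_ : Carrier → Carrier → Set
  a ≤ b = (a ⊓ b) ≡ a

  eval : (ℕ → Carrier) → Fm → Carrier
  eval v (var n)  = v n
  eval v (a ∧ᶠ b) = eval v a ⊓ eval v b
  eval v (a ∨ᶠ b) = eval v a ⊔ eval v b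
  eval v (¬ᶠ a)   = ∼ (eval v a)

IsUpset : (A : DeMorganLattice) → (DeMorganLattice.Carrier A → Set) → Set
IsUpset A F = ∀ a b → F a → a ≤ b → F b
  where open DeMorganLattice A

ValidIn : (A : DeMorganLattice) → (DeMorganLattice.Carrier A → Set) → FmSet → Fm → Set
ValidIn A F Γ φ = ∀ (v : ℕ → Carrier) → (∀ γ → Γ γ → F (eval v γ)) → F (eval v φ)
  where open DeMorganLattice A

BD∞ : Rel⊢
BD∞ Γ φ = ∀ (A : DeMorganLattice) (F : DeMorganLattice.Carrier A → Set)
          → IsUpset A F → ValidIn A F Γ φ

evalB : (ℕ → Bool) → Fm → Bool
evalB v (var n)  = v n
evalB v (a ∧ᶠ b) = evalB v a ∧ evalB v b
evalB v (a ∨ᶠ b) = evalB v a ∨ evalB v b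
evalB v (¬ᶠ a)   = not (evalB v a)

CL₁ : Rel⊢
CL₁ Γ φ = Level.Lift (lsuc lzero)
  (∀ (v : ℕ → Bool) → (∀ γ → Γ γ → evalB v γ ≡ true) → evalB v φ ≡ true)

TRIV : Rel⊢
TRIV Γ φ = Level.Lift (lsuc lzero) Data.Unit.⊤ where import Data.Unit

TRIV₋ : Rel⊢
TRIV₋ Γ φ = Level.Lift (lsuc lzero) (∃ λ ψ → Γ ψ)

Extends : Rel⊢ → Rel⊢ → Set₁
Extends L K = ∀ Γ φ → K Γ φ → L Γ φ

-- formulas in the two variables x = var 0, y = var 1
InTwoVars : Fm → Set
InTwoVars (var n)  = (n ≡ 0) ⊎ (n ≡ 1)
InTwoVars (a ∧ᶠ b) = InTwoVars a × InTwoVars b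
InTwoVars (a ∨ᶠ b) = InTwoVars a × InTwoVars b
InTwoVars (¬ᶠ a)   = InTwoVars a

yx : Subst
yx 1 = var 0
yx n = var n

x∪ : FmSet → FmSet
x∪ Δ ψ = (ψ ≡ var 0) ⊎ Δ ψ

IsProtoalgebraic : Rel⊢ → Set₁
IsProtoalgebraic L =
  Σ FmSet λ Δ → (∀ δ → Δ δ → InTwoVars δ)
              × (∀ δ → Δ δ → L ∅ (δ [ yx ]))
              × L (x∪ Δ) (var 1)

IsProtoExtBD∞ : Rel⊢ → Set₁
IsProtoExtBD∞ L = IsLogic L × Extends L BD∞ × IsProtoalgebraic L

_≋_ : Rel⊢ → Rel⊢ → Set₁
L ≋ K = ∀ Γ φ → L Γ φ ⇔ K Γ φ

{-# OPTIONS --safe #-}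

-- A Boolean assignment s determines a conjunction of literals that lies, in every De Morgan
-- lattice, below each formula true under s and below the negation of each formula false under s.
-- Applied to the two constant assignments of x and y, this shows that unless the extension L is
-- trivial every δ ∈ Δ lies above x ↔ y = (x ∧ y) ∨ (¬ x ∧ ¬ y), and that x ∨ ¬ x is a theorem.
-- Hence L has the rule x, x ↔ y ⊢ y.  If p and q = r ∨ ¬ r are theorems, then so is
-- p ↔ (p ∧ q), as it lies above α ∨ ¬ α for α = (p ∧ q) ∨ ¬ p; thus conjunctions of instances of
-- excluded middle are theorems, and by distributivity each tautology lies above such a
-- conjunction.  When a entails b classically, a ↔ (a ∧ b) is a tautology, so a ⊢ b; and
-- adjunction holds because z classically entails x ↔ (x ∧ z).
module Submission where

open import Defs
open import Level using (lift; lower) renaming (suc to lsuc; zero to lzero)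
open import Algebra.Lattice.Bundles using (DistributiveLattice)
import Algebra.Lattice.Properties.Lattice as LatticeProperties
import Algebra.Lattice.Structures as LS
open import Axiom.ExcludedMiddle using (ExcludedMiddle)
open import Data.Bool using (Bool; true; false; not; if_then_else_)
open import Data.Bool.Properties using (∨-∧-isDistributiveLattice; not-involutive)
open import Data.Nat using (ℕ; zero; suc; _<_; z≤n) renaming (_≤_ to _≤ℕ_; _⊔_ to _⊔ℕ_)
import Data.Nat.Properties as ℕ
open import Data.Product using (∃; _×_; _,_; proj₂)
open import Data.Sum using (_⊎_; inj₁; inj₂)
open import Data.Unit using (tt)
open import Function.Bundles using (mk⇔)
open import Relation.Binary.Lattice using (Lattice)
open import Relation.Binary.PropositionalEquality
  using (_≡_; refl; sym; trans; cong; cong₂; subst; ≢-sym)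
open import Relation.Nullary using (¬_; yes; no; does; contradiction)

-- Formulas and bounds on their variables

infix 5 _↔ᶠ_

_↔ᶠ_ : Fm → Fm → Fm
a ↔ᶠ b = (a ∧ᶠ b) ∨ᶠ ((¬ᶠ a) ∧ᶠ (¬ᶠ b))

excludedMiddle : Fm → Fm
excludedMiddle a = a ∨ᶠ (¬ᶠ a)

-- The language has no constant for truth, so an instance of excluded middle stands in for the empty
-- conjunction.
excludedMiddles : ℕ → Fm
excludedMiddles zero    = excludedMiddle (var zero)
excludedMiddles (suc n) = excludedMiddles n ∧ᶠ excludedMiddle (var n)

_⊨_ : Fm → Fm → Set
a ⊨ b = ∀ w → evalB w a ≡ true → evalB w b ≡ true

Tautology : Fm → Set
Tautology a = ∀ w → evalB w a ≡ true

AllVars : (ℕ → Set) → Fm → Set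
AllVars P (var n)  = P n
AllVars P (a ∧ᶠ b) = AllVars P a × AllVars P b
AllVars P (a ∨ᶠ b) = AllVars P a × AllVars P b
AllVars P (¬ᶠ a)   = AllVars P a

AllVars-map : ∀ {P Q} → (∀ n → P n → Q n) → ∀ a → AllVars P a → AllVars Q a
AllVars-map f (var n)  p       = f n p
AllVars-map f (a ∧ᶠ b) (p , q) = AllVars-map f a p , AllVars-map f b q
AllVars-map f (a ∨ᶠ b) (p , q) = AllVars-map f a p , AllVars-map f b q
AllVars-map f (¬ᶠ a)   p       = AllVars-map f a p

AllVars-universal : ∀ {P} → (∀ n → P n) → ∀ a → AllVars P a
AllVars-universal f (var n)  = f n
AllVars-universal f (a ∧ᶠ b) = AllVars-universal f a , AllVars-universal f b
AllVars-universal f (a ∨ᶠ b) = AllVars-universal f a , AllVars-universal f b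
AllVars-universal f (¬ᶠ a)   = AllVars-universal f a

InTwoVars⇒AllVars : ∀ {P} → P 0 → P 1 → ∀ a → InTwoVars a → AllVars P a
InTwoVars⇒AllVars p q (var .0) (inj₁ refl) = p
InTwoVars⇒AllVars p q (var .1) (inj₂ refl) = q
InTwoVars⇒AllVars p q (a ∧ᶠ b) (r , s) = InTwoVars⇒AllVars p q a r , InTwoVars⇒AllVars p q b s
InTwoVars⇒AllVars p q (a ∨ᶠ b) (r , s) = InTwoVars⇒AllVars p q a r , InTwoVars⇒AllVars p q b s
InTwoVars⇒AllVars p q (¬ᶠ a)   r       = InTwoVars⇒AllVars p q a r

bound : Fm → ℕ
bound (var n)  = suc n
bound (a ∧ᶠ b) = bound a ⊔ℕ bound b
bound (a ∨ᶠ b) = bound a ⊔ℕ bound b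
bound (¬ᶠ a)   = bound a

vars<bound : ∀ a → AllVars (_< bound a) a
vars<bound (var n)  = ℕ.≤-refl
vars<bound (a ∧ᶠ b) =
  AllVars-map (λ _ p → ℕ.≤-trans p (ℕ.m≤m⊔n _ _)) a (vars<bound a) ,
  AllVars-map (λ _ p → ℕ.≤-trans p (ℕ.m≤n⊔m (bound a) _)) b (vars<bound b)
vars<bound (a ∨ᶠ b) =
  AllVars-map (λ _ p → ℕ.≤-trans p (ℕ.m≤m⊔n _ _)) a (vars<bound a) ,
  AllVars-map (λ _ p → ℕ.≤-trans p (ℕ.m≤n⊔m (bound a) _)) b (vars<bound b)
vars<bound (¬ᶠ a)   = vars<bound a

-- Boolean semantics

evalB-agree : ∀ v w a → AllVars (λ n → v n ≡ w n) a → evalB v a ≡ evalB w a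
evalB-agree v w (var n)  p       = p
evalB-agree v w (a ∧ᶠ b) (p , q) = cong₂ Data.Bool._∧_ (evalB-agree v w a p) (evalB-agree v w b q)
evalB-agree v w (a ∨ᶠ b) (p , q) = cong₂ Data.Bool._∨_ (evalB-agree v w a p) (evalB-agree v w b q)
evalB-agree v w (¬ᶠ a)   p       = cong not (evalB-agree v w a p)

evalB-subst : ∀ w σ a → evalB w (a [ σ ]) ≡ evalB (λ n → evalB w (σ n)) a
evalB-subst w σ (var n)  = refl
evalB-subst w σ (a ∧ᶠ b) = cong₂ Data.Bool._∧_ (evalB-subst w σ a) (evalB-subst w σ b)
evalB-subst w σ (a ∨ᶠ b) = cong₂ Data.Bool._∨_ (evalB-subst w σ a) (evalB-subst w σ b)
evalB-subst w σ (¬ᶠ a)   = cong not (evalB-subst w σ a)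

excludedMiddle-tautology : ∀ a → Tautology (excludedMiddle a)
excludedMiddle-tautology a w with evalB w a
... | true  = refl
... | false = refl

∨-falseˡ : ∀ w a b → evalB w (a ∨ᶠ b) ≡ false → evalB w a ≡ false
∨-falseˡ w a b p with evalB w a
... | false = refl

∨-falseʳ : ∀ w a b → evalB w (a ∨ᶠ b) ≡ false → evalB w b ≡ false
∨-falseʳ w a b p with evalB w a
... | false = p

¬-false : ∀ w a → evalB w (¬ᶠ a) ≡ false → evalB w a ≡ true
¬-false w a p with evalB w a
... | true = refl

⊨⇒↔-tautology : ∀ a b → a ⊨ b → Tautology (a ↔ᶠ (a ∧ᶠ b))
⊨⇒↔-tautology a b a⊨b w with evalB w a | evalB w b | a⊨b w
... | true  | true  | _ = refl
... | true  | false | f = f refl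
... | false | _     | _ = refl

resolution-⊨ : ∀ a b → ((a ∨ᶠ b) ∧ᶠ (a ∨ᶠ (¬ᶠ b))) ⊨ a
resolution-⊨ a b w p with evalB w a | evalB w b
... | true  | _     = refl
... | false | true  = p
... | false | false = p

⊨-↔-∧ : ∀ a b → b ⊨ (a ↔ᶠ (a ∧ᶠ b))
⊨-↔-∧ a b w p with evalB w a | evalB w b
... | true  | true  = refl
... | false | _     = refl
⊨-↔-∧ a b w () | true | false

mp-⊨ : ∀ a b → (a ∧ᶠ (a ↔ᶠ b)) ⊨ b
mp-⊨ a b w p with evalB w a | evalB w b
... | true | true = refl

↔-refl : ∀ a → Tautology (a ↔ᶠ a)
↔-refl a w with evalB w a
... | true  = refl
... | false = refl

-- Inequalities valid in all De Morgan lattices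

module DeMorganProperties (A : DeMorganLattice) where
  open DeMorganLattice A
  open LS.IsDistributiveLattice isDistributiveLattice using (∧-distribˡ-∨)

  private
    distributiveLattice : DistributiveLattice lzero lzero
    distributiveLattice = record { isDistributiveLattice = isDistributiveLattice }

    module O = Lattice (LatticeProperties.∨-∧-orderTheoreticLattice
                          (DistributiveLattice.lattice distributiveLattice))

  ≤-refl : ∀ {x} → x ≤ x
  ≤-refl = sym O.refl

  ≤-trans : ∀ {x y z} → x ≤ y → y ≤ z → x ≤ z
  ≤-trans p q = sym (O.trans (sym p) (sym q))

  ≤-reflexive : ∀ {x y} → x ≡ y → x ≤ y
  ≤-reflexive refl = ≤-refl

  ⊓-lowerˡ : ∀ {x y} → (x ⊓ y) ≤ x
  ⊓-lowerˡ = sym (O.x∧y≤x _ _)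

  ⊓-lowerʳ : ∀ {x y} → (x ⊓ y) ≤ y
  ⊓-lowerʳ = sym (O.x∧y≤y _ _)

  ⊓-greatest : ∀ {x y z} → x ≤ y → x ≤ z → x ≤ (y ⊓ z)
  ⊓-greatest p q = sym (O.∧-greatest (sym p) (sym q))

  ⊔-upperˡ : ∀ {x y} → x ≤ (x ⊔ y)
  ⊔-upperˡ = sym (O.x≤x∨y _ _)

  ⊔-upperʳ : ∀ {x y} → y ≤ (x ⊔ y)
  ⊔-upperʳ = sym (O.y≤x∨y _ _)

  ⊔-least : ∀ {x y z} → x ≤ z → y ≤ z → (x ⊔ y) ≤ z
  ⊔-least p q = sym (O.∨-least (sym p) (sym q))

  ⊓-⊔-least : ∀ {x y z t} → (x ⊓ y) ≤ t → (x ⊓ z) ≤ t → (x ⊓ (y ⊔ z)) ≤ t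
  ⊓-⊔-least p q = ≤-trans (≤-reflexive (∧-distribˡ-∨ _ _ _)) (⊔-least p q)

  ∼-antitone : ∀ {x y} → x ≤ y → (∼ y) ≤ (∼ x)
  ∼-antitone {x} {y} p =
    ≤-trans ⊔-upperʳ (≤-reflexive (trans (sym (deMorgan-⊓ x y)) (cong ∼_ p)))

  ∼-swap : ∀ {x y} → x ≤ (∼ y) → y ≤ (∼ x)
  ∼-swap {x} {y} p = ≤-trans (≤-reflexive (sym (∼-involutive y))) (∼-antitone p)

  eval-subst : ∀ v σ a → eval v (a [ σ ]) ≡ eval (λ n → eval v (σ n)) a
  eval-subst v σ (var n)  = refl
  eval-subst v σ (a ∧ᶠ b) = cong₂ _⊓_ (eval-subst v σ a) (eval-subst v σ b)
  eval-subst v σ (a ∨ᶠ b) = cong₂ _⊔_ (eval-subst v σ a) (eval-subst v σ b)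
  eval-subst v σ (¬ᶠ a)   = cong ∼_ (eval-subst v σ a)

  signed : Bool → Carrier → Carrier
  signed b x = if b then x else ∼ x

  -- Induction on `a`, with the De Morgan laws handling the false cases. An arbitrary lower bound
  -- `m` of the literals replaces their meet, so literals can be added one at a time.
  minterm-≤ : ∀ {m} s v a → AllVars (λ n → m ≤ signed (s n) (v n)) a →
              m ≤ signed (evalB s a) (eval v a)
  minterm-≤ s v (var n) p = p
  minterm-≤ s v (a ∧ᶠ b) (p , q) with evalB s a | evalB s b | minterm-≤ s v a p | minterm-≤ s v b q
  ... | true  | true  | r | t = ⊓-greatest r t
  ... | true  | false | r | t = ≤-trans t (≤-trans ⊔-upperʳ (≤-reflexive (sym (deMorgan-⊓ _ _))))
  ... | false | _     | r | t = ≤-trans r (≤-trans ⊔-upperˡ (≤-reflexive (sym (deMorgan-⊓ _ _))))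
  minterm-≤ s v (a ∨ᶠ b) (p , q) with evalB s a | evalB s b | minterm-≤ s v a p | minterm-≤ s v b q
  ... | true  | _     | r | t = ≤-trans r ⊔-upperˡ
  ... | false | true  | r | t = ≤-trans t ⊔-upperʳ
  ... | false | false | r | t = ≤-trans (⊓-greatest r t) (≤-reflexive (sym (deMorgan-⊔ _ _)))
  minterm-≤ s v (¬ᶠ a) p with evalB s a | minterm-≤ s v a p
  ... | true  | r = ≤-trans r (≤-reflexive (sym (∼-involutive _)))
  ... | false | r = r

  -- Being below both a value and its negation is preserved by all connectives. With `m` equal to x
  -- ∧ ¬x this bounds every formula in x alone.
  contradictory-≤ : ∀ {m} v a → AllVars (λ n → m ≤ v n × m ≤ (∼ v n)) a →
                    m ≤ eval v a × m ≤ (∼ eval v a)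
  contradictory-≤ v (var n)  p = p
  contradictory-≤ v (a ∧ᶠ b) (p , q) =
    let r , r′ = contradictory-≤ v a p ; t , _ = contradictory-≤ v b q in
    ⊓-greatest r t , ≤-trans r′ (∼-antitone ⊓-lowerˡ)
  contradictory-≤ v (a ∨ᶠ b) (p , q) =
    let r , r′ = contradictory-≤ v a p ; _ , t′ = contradictory-≤ v b q in
    ≤-trans r ⊔-upperˡ , ≤-trans (⊓-greatest r′ t′) (≤-reflexive (sym (deMorgan-⊔ _ _)))
  contradictory-≤ v (¬ᶠ a) p =
    let r , r′ = contradictory-≤ v a p in
    r′ , ≤-trans r (≤-reflexive (sym (∼-involutive _)))

-- Order between formulas in all De Morgan lattices

infix 4 _⊑_

_⊑_ : Fm → Fm → Set₁
a ⊑ b = ∀ A v → DeMorganLattice._≤_ A (DeMorganLattice.eval A v a) (DeMorganLattice.eval A v b)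

⊑⇒BD∞ : ∀ a b → a ⊑ b → BD∞ (_≡ a) b
⊑⇒BD∞ a b p A F up v h = up _ _ (h a refl) (p A v)

update : (ℕ → Bool) → ℕ → Bool → ℕ → Bool
update s k b n with n ℕ.≟ k
... | yes _ = b
... | no _  = s n

excludedMiddles-⊑ : ∀ N a → AllVars (_< N) a → Tautology a → excludedMiddles N ⊑ a
excludedMiddles-⊑ N a vars taut A v =
  -- At `k = N` no literal is fixed yet, so the condition on literals is vacuous, the initial
  -- assignment is arbitrary, and `m` can be the conjunction itself.
  ≤-trans (⊓-greatest ≤-refl ≤-refl)
    (expand N (λ _ → true) (λ n N≤n n<N → contradiction (ℕ.≤-trans n<N N≤n) (ℕ.<-irrefl refl)))
  where
  open DeMorganLattice A
  open DeMorganProperties A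

  -- Variables below `k` are still undecided; `s` holds the signs chosen for those from `k` up to
  -- `N`. Distributing over excluded middle for the next variable gives one branch per sign.
  expand : ∀ k s {m} → (∀ n → k ≤ℕ n → n < N → m ≤ signed (s n) (v n)) →
           (m ⊓ eval v (excludedMiddles k)) ≤ eval v a
  -- Every variable of `a` is decided, so `m` alone lies below `a`; the leftover instance of
  -- excluded middle is dropped.
  expand zero s {m} lits = ≤-trans ⊓-lowerˡ
    (subst (λ b → m ≤ signed b (eval v a)) (taut s)
      (minterm-≤ s v a (AllVars-map (λ n → lits n z≤n) a vars)))
  expand (suc k) s {m} lits =
    ≤-trans (⊓-greatest (⊓-greatest ⊓-lowerˡ (≤-trans ⊓-lowerʳ ⊓-lowerˡ))
                         (≤-trans ⊓-lowerʳ ⊓-lowerʳ))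
             (⊓-⊔-least (branch true) (branch false))
    where
    e = eval v (excludedMiddles k)

    branch : ∀ b → ((m ⊓ e) ⊓ signed b (v k)) ≤ eval v a
    branch b = ≤-trans
      (⊓-greatest (⊓-greatest (≤-trans ⊓-lowerˡ ⊓-lowerˡ) ⊓-lowerʳ) (≤-trans ⊓-lowerˡ ⊓-lowerʳ))
      (expand k (update s k b) lits′)
      where
      lits′ : ∀ n → k ≤ℕ n → n < N → (m ⊓ signed b (v k)) ≤ signed (update s k b n) (v n)
      lits′ n k≤n n<N with n ℕ.≟ k
      ... | yes refl = ⊓-lowerʳ
      ... | no n≢k   = ≤-trans ⊓-lowerˡ (lits n (ℕ.≤∧≢⇒< k≤n (≢-sym n≢k)) n<N)

-- Write α = (p ∧ q) ∨ ¬p. Both disjuncts of α lie below the biconditional. Its negation is (¬p ∨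
-- ¬q) ∧ p: the part with ¬p is below ¬p, and the part with ¬q is below p ∧ q because ¬q ≤ q when q
-- is an excluded middle.
↔-∧-excludedMiddle-⊑ : ∀ p r → let q = excludedMiddle r in
  excludedMiddle ((p ∧ᶠ q) ∨ᶠ (¬ᶠ p)) ⊑ (p ↔ᶠ (p ∧ᶠ q))
↔-∧-excludedMiddle-⊑ p r A v =
  ⊔-least (⊔-least pq≤ ¬p≤)
          (≤-trans (⊓-greatest (≤-trans ¬α≤ ⊓-lowerʳ) (≤-trans ¬α≤ ⊓-lowerˡ))
                    (⊓-⊔-least (≤-trans ⊓-lowerʳ ¬p≤)
                               (≤-trans (⊓-greatest ⊓-lowerˡ (≤-trans ⊓-lowerʳ ¬q≤q)) pq≤)))
  where
  open DeMorganLattice A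
  open DeMorganProperties A
  x = eval v p
  z = eval v r
  q = z ⊔ (∼ z)
  R = (x ⊓ (x ⊓ q)) ⊔ ((∼ x) ⊓ (∼ (x ⊓ q)))

  pq≤ : (x ⊓ q) ≤ R
  pq≤ = ≤-trans (⊓-greatest ⊓-lowerˡ ≤-refl) ⊔-upperˡ

  ¬p≤ : (∼ x) ≤ R
  ¬p≤ = ≤-trans (⊓-greatest ≤-refl (∼-antitone ⊓-lowerˡ)) ⊔-upperʳ

  ¬q≤q : (∼ q) ≤ q
  ¬q≤q = ≤-trans (∼-antitone ⊔-upperˡ) ⊔-upperʳ

  ¬α≤ : (∼ ((x ⊓ q) ⊔ (∼ x))) ≤ (((∼ x) ⊔ (∼ q)) ⊓ x)
  ¬α≤ = ≤-trans (≤-reflexive (deMorgan-⊔ _ _))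
    (⊓-greatest (≤-trans ⊓-lowerˡ (≤-reflexive (deMorgan-⊓ _ _)))
                (≤-trans ⊓-lowerʳ (≤-reflexive (∼-involutive _))))

module _ (δ : Fm) (δ-vars : InTwoVars δ) where

  -- By `contradictory-≤`, x ∧ ¬x lies below ¬δ(x,x); contraposing gives the bound. A single member
  -- of Δ thus makes excluded middle a theorem.
  collapse-⊑-excludedMiddle : δ [ yx ] ⊑ excludedMiddle (var 0)
  collapse-⊑-excludedMiddle A v rewrite DeMorganProperties.eval-subst A v yx δ =
    ≤-trans
      (∼-swap (proj₂ (contradictory-≤ (λ n → eval v (yx n)) δ
        (InTwoVars⇒AllVars lits lits δ δ-vars))))
      (≤-trans (≤-reflexive (deMorgan-⊓ _ _))
                (⊔-least ⊔-upperʳ (≤-trans (≤-reflexive (∼-involutive _)) ⊔-upperˡ)))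
    where
    open DeMorganLattice A
    open DeMorganProperties A
    lits : (v 0 ⊓ (∼ v 0)) ≤ v 0 × (v 0 ⊓ (∼ v 0)) ≤ (∼ v 0)
    lits = ⊓-lowerˡ , ⊓-lowerʳ

  -- The all-true minterm collapses to x, so x ≤ ¬δ(x,x). If δ(x,x) is a theorem, ¬x becomes one
  -- too.
  collapse-⊑-¬var : evalB (λ _ → true) δ ≡ false → δ [ yx ] ⊑ ¬ᶠ (var 0)
  collapse-⊑-¬var δ≡false A v rewrite DeMorganProperties.eval-subst A v yx δ =
    ∼-swap (subst (λ b → v 0 ≤ signed b (eval (λ n → eval v (yx n)) δ)) δ≡false
      (minterm-≤ (λ _ → true) (λ n → eval v (yx n)) δ
          (InTwoVars⇒AllVars ≤-refl ≤-refl δ δ-vars)))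
    where
    open DeMorganLattice A
    open DeMorganProperties A

  -- The all-false minterm collapses to ¬x, so ¬x ≤ ¬δ(x,x). If δ(x,x) is a theorem, so is x.
  collapse-⊑-var : evalB (λ _ → false) δ ≡ false → δ [ yx ] ⊑ var 0
  collapse-⊑-var δ≡false A v rewrite DeMorganProperties.eval-subst A v yx δ =
    ≤-trans
      (∼-swap (subst (λ b → (∼ v 0) ≤ signed b (eval (λ n → eval v (yx n)) δ)) δ≡false
        (minterm-≤ (λ _ → false) (λ n → eval v (yx n)) δ
          (InTwoVars⇒AllVars ≤-refl ≤-refl δ δ-vars))))
      (≤-reflexive (∼-involutive _))
    where
    open DeMorganLattice A
    open DeMorganProperties A

  -- The two disjuncts of the biconditional are exactly the all-true and all-false minterms in x and
  -- y.
  ↔-⊑ : evalB (λ _ → true) δ ≡ true → evalB (λ _ → false) δ ≡ true → (var 0 ↔ᶠ var 1) ⊑ δ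
  ↔-⊑ δ≡true δ≡true′ A v = ⊔-least
    (subst (λ b → (v 0 ⊓ v 1) ≤ signed b (eval v δ)) δ≡true
      (minterm-≤ (λ _ → true) v δ (InTwoVars⇒AllVars ⊓-lowerˡ ⊓-lowerʳ δ δ-vars)))
    (subst (λ b → ((∼ v 0) ⊓ (∼ v 1)) ≤ signed b (eval v δ)) δ≡true′
      (minterm-≤ (λ _ → false) v δ (InTwoVars⇒AllVars ⊓-lowerˡ ⊓-lowerʳ δ δ-vars)))
    where
    open DeMorganLattice A
    open DeMorganProperties A

-- Classical logic

boolDeMorganLattice : DeMorganLattice
boolDeMorganLattice = record
  { Carrier               = Bool
  ; _⊓_                   = Data.Bool._∧_
  ; _⊔_                   = Data.Bool._∨_
  ; ∼_                    = not
  ; isDistributiveLattice = ∨-∧-isDistributiveLattice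
  ; ∼-involutive          = not-involutive
  ; deMorgan-⊓            = λ { true _ → refl ; false _ → refl }
  ; deMorgan-⊔            = λ { true _ → refl ; false _ → refl }
  }

eval-bool : ∀ v a → DeMorganLattice.eval boolDeMorganLattice v a ≡ evalB v a
eval-bool v (var n)  = refl
eval-bool v (a ∧ᶠ b) = cong₂ Data.Bool._∧_ (eval-bool v a) (eval-bool v b)
eval-bool v (a ∨ᶠ b) = cong₂ Data.Bool._∨_ (eval-bool v a) (eval-bool v b)
eval-bool v (¬ᶠ a)   = cong not (eval-bool v a)

CL₁-isLogic : IsLogic CL₁
CL₁-isLogic = record
  { reflexive    = λ Γ φ φ∈Γ → lift λ v h → h φ φ∈Γ
  ; monotone     = λ Γ Δ φ Γ⊆Δ p → lift λ v h → lower p v λ γ γ∈Γ → h γ (Γ⊆Δ γ γ∈Γ)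
  ; cut          = λ Γ Δ φ p q → lift λ v h → lower q v λ δ δ∈Δ → lower (p δ δ∈Δ) v h
  ; substitution = λ Γ φ σ p → lift λ v h → trans (evalB-subst v σ φ)
      (lower p _ λ γ γ∈Γ → trans (sym (evalB-subst v σ γ)) (h _ (γ , γ∈Γ , refl)))
  }

CL₁-extends-BD∞ : Extends CL₁ BD∞
CL₁-extends-BD∞ Γ φ p = lift λ v h → trans (sym (eval-bool v φ))
  (p boolDeMorganLattice (_≡ true) up v λ γ γ∈Γ → trans (eval-bool v γ) (h γ γ∈Γ))
  where
  up : IsUpset boolDeMorganLattice (_≡ true)
  up true b _ a≤b = a≤b

CL₁-isProtoalgebraic : IsProtoalgebraic CL₁
CL₁-isProtoalgebraic =
  (_≡ (var 0 ↔ᶠ var 1)) ,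
  (λ { _ refl → (inj₁ refl , inj₂ refl) , (inj₁ refl , inj₂ refl) }) ,
  (λ { _ refl → lift λ v _ → ↔-refl (var 0) v }) ,
  lift λ v h → mp-⊨ (var 0) (var 1) v
    (cong₂ Data.Bool._∧_ (h _ (inj₁ refl)) (h _ (inj₂ refl)))

-- Protoalgebraic extensions

module Extension (em : ExcludedMiddle (lsuc lzero))
                 (L : Rel⊢) (isLogic : IsLogic L) (ext : Extends L BD∞) where
  open IsLogic isLogic

  instantiate : ∀ {Γ Γ′ φ} σ → L Γ φ → (∀ γ → Γ γ → L Γ′ (γ [ σ ])) → L Γ′ (φ [ σ ])
  instantiate σ p h = cut _ _ _ (λ { _ (γ , γ∈Γ , refl) → h γ γ∈Γ }) (substitution _ _ σ p)

  theorem-subst : ∀ φ σ → L ∅ φ → L ∅ (φ [ σ ])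
  theorem-subst φ σ p = instantiate σ p λ _ ()

  weaken : ∀ {Γ φ} → L ∅ φ → L Γ φ
  weaken = monotone _ _ _ λ _ ()

  ⊑-mp : ∀ {Γ} a b → a ⊑ b → L Γ a → L Γ b
  ⊑-mp a b p q = cut _ _ _ (λ { _ refl → q }) (ext _ _ (⊑⇒BD∞ a b p))

  ⊢var⇒TRIV : L ∅ (var 0) → L ≋ TRIV
  ⊢var⇒TRIV p Γ φ = mk⇔ (λ _ → lift tt) (λ _ → weaken (theorem-subst (var 0) (λ _ → φ) p))

  -- Classical logic from excluded middle and detachment for the biconditional

  module WithDetachment (⊬var : ¬ L ∅ (var 0))
                        (⊢EM : L ∅ (excludedMiddle (var 0)))
                        (detach : ∀ {Γ} a b → L Γ a → L Γ (a ↔ᶠ b) → L Γ b) where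

    ⊢excludedMiddles : ∀ n → L ∅ (excludedMiddles n)
    ⊢excludedMiddles zero    = ⊢EM
    ⊢excludedMiddles (suc n) = detach p (p ∧ᶠ q) (⊢excludedMiddles n)
      (⊑-mp (excludedMiddle α) (p ↔ᶠ (p ∧ᶠ q)) (↔-∧-excludedMiddle-⊑ p (var n))
        (theorem-subst (excludedMiddle (var 0)) (λ _ → α) ⊢EM))
      where
      p = excludedMiddles n
      q = excludedMiddle (var n)
      α = (p ∧ᶠ q) ∨ᶠ (¬ᶠ p)

    ⊢tautology : ∀ {a} → Tautology a → L ∅ a
    ⊢tautology {a} taut =
      ⊑-mp (excludedMiddles (bound a)) a (excludedMiddles-⊑ (bound a) a (vars<bound a) taut)
        (⊢excludedMiddles (bound a))

    ⊨-mp : ∀ {Γ a b} → a ⊨ b → L Γ a → L Γ b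
    ⊨-mp {a = a} {b} a⊨b p = ⊑-mp (a ∧ᶠ b) b
      (λ A v → DeMorganProperties.⊓-lowerʳ A {x = DeMorganLattice.eval A v a})
      (detach a (a ∧ᶠ b) p (weaken (⊢tautology (⊨⇒↔-tautology a b a⊨b))))

    adjunction : ∀ {Γ a b} → L Γ a → L Γ b → L Γ (a ∧ᶠ b)
    adjunction {a = a} {b} p q = detach a (a ∧ᶠ b) p (⊨-mp (⊨-↔-∧ a b) q)

    resolution : ∀ {Γ} a b → L Γ (a ∨ᶠ b) → L Γ (a ∨ᶠ (¬ᶠ b)) → L Γ a
    resolution a b p q = ⊨-mp (resolution-⊨ a b) (adjunction p q)

    -- Given a valuation that satisfies Γ and refutes φ, replace each variable by a tautology or a
    -- contradiction according to its value. The premises become tautologies and φ a contradiction,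
    -- so x would be a theorem.
    sound : ∀ Γ φ → L Γ φ → CL₁ Γ φ
    sound Γ φ p = lift refute
      where
      constant : Bool → Fm
      constant b = if b then excludedMiddle (var 0) else ¬ᶠ (excludedMiddle (var 0))

      evalB-constant : ∀ w b → evalB w (constant b) ≡ b
      evalB-constant w true  = excludedMiddle-tautology (var 0) w
      evalB-constant w false = cong not (excludedMiddle-tautology (var 0) w)

      refute : ∀ v → (∀ γ → Γ γ → evalB v γ ≡ true) → evalB v φ ≡ true
      refute v h with evalB v φ in φ-false
      ... | true  = refl
      ... | false = contradiction
          -- The substituted φ is false everywhere, hence classically entails x vacuously.
          (⊨-mp (λ w q → contradiction (trans (sym q) (trans (evalB-ground φ w) φ-false)) λ ())
            (instantiate σ p λ γ γ∈Γ → ⊢tautology λ w → trans (evalB-ground γ w) (h γ γ∈Γ)))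
          ⊬var
        where
        σ : Subst
        σ n = constant (v n)

        evalB-ground : ∀ a w → evalB w (a [ σ ]) ≡ evalB v a
        evalB-ground a w = trans (evalB-subst w σ a)
          (evalB-agree _ _ a (AllVars-universal (λ n → evalB-constant w (v n)) a))

    -- L need not be finitary, so no deduction theorem is available.  Instead, if Γ ⊬ φ, a
    -- clause of literals is attached to φ one variable at a time, keeping it unprovable from Γ;
    -- the only valuation refuting all of the resulting clauses satisfies Γ and refutes φ.
    module Completeness (Γ : FmSet) (φ : Fm) (⊬φ : ¬ L Γ φ) where

      choice : Fm → ℕ → Bool
      choice ψ n = does (em {L Γ (ψ ∨ᶠ var n)})

      -- The polarity is reversed: the literal is false exactly when the variable has value `b`, so
      -- refuting a clause forces the chosen values.
      literal : Bool → ℕ → Fm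
      literal b n = if b then ¬ᶠ (var n) else var n

      clause : ℕ → Fm
      clause zero    = φ
      clause (suc n) = clause n ∨ᶠ literal (choice (clause n) n) n

      valuation : ℕ → Bool
      valuation n = choice (clause n) n

      -- If ψ ∨ x is provable from Γ, then ψ ∨ ¬x cannot be, since resolution would yield ψ;
      -- otherwise x itself is attached.
      ⊬-step : ∀ ψ n → ¬ L Γ ψ → ¬ L Γ (ψ ∨ᶠ literal (choice ψ n) n)
      ⊬-step ψ n ⊬ψ with em {L Γ (ψ ∨ᶠ var n)}
      ... | yes p = λ q → ⊬ψ (resolution ψ (var n) p q)
      ... | no ⊬p = ⊬p

      ⊬clause : ∀ n → ¬ L Γ (clause n)
      ⊬clause zero    = ⊬φ
      ⊬clause (suc n) = ⊬-step (clause n) n (⊬clause n)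

      clause-false⇒φ-false : ∀ w n → evalB w (clause n) ≡ false → evalB w φ ≡ false
      clause-false⇒φ-false w zero    p = p
      clause-false⇒φ-false w (suc n) p =
        clause-false⇒φ-false w n (∨-falseˡ w (clause n) (literal (valuation n) n) p)

      literal-false : ∀ w b n → evalB w (literal b n) ≡ false → w n ≡ b
      literal-false w true  n p = ¬-false w (var n) p
      literal-false w false n p = p

      clause-false⇒agree : ∀ w n → evalB w (clause n) ≡ false → ∀ k → k < n → w k ≡ valuation k
      clause-false⇒agree w (suc n) p k k<1+n with ℕ.m<1+n⇒m<n∨m≡n k<1+n
      ... | inj₁ k<n  =
        clause-false⇒agree w n (∨-falseˡ w (clause n) (literal (valuation n) n) p) k k<n
      ... | inj₂ refl =
        literal-false w (valuation n) n (∨-falseʳ w (clause n) (literal (valuation n) n) p)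

      clause-false⇒evalB : ∀ w a → evalB w (clause (bound a)) ≡ false →
                           evalB w a ≡ evalB valuation a
      clause-false⇒evalB w a p =
        evalB-agree w valuation a (AllVars-map (clause-false⇒agree w (bound a) p) a (vars<bound a))

      -- A valuation refuting `clause (bound γ)` agrees with `valuation` on all variables of γ. Were
      -- γ false there, γ would classically entail that clause, making it provable from Γ.
      valuation-true : ∀ γ → Γ γ → evalB valuation γ ≡ true
      valuation-true γ γ∈Γ with evalB valuation γ in γ-false
      ... | true  = refl
      ... | false = contradiction (⊨-mp γ⊨clause (reflexive Γ γ γ∈Γ)) (⊬clause (bound γ))
        where
        γ⊨clause : γ ⊨ clause (bound γ)
        γ⊨clause w γ-true with evalB w (clause (bound γ)) in clause-false
        ... | true  = refl
        ... | false = trans (sym γ-false) (trans (sym (clause-false⇒evalB w γ clause-false)) γ-true)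

      -- Refuting `clause (bound φ)` falsifies its disjunct φ but also forces agreement with
      -- `valuation` on φ. Were φ true there, the clause would be a tautology.
      valuation-false : ¬ evalB valuation φ ≡ true
      valuation-false φ-true = ⊬clause (bound φ) (weaken (⊢tautology taut))
        where
        taut : Tautology (clause (bound φ))
        taut w with evalB w (clause (bound φ)) in clause-false
        ... | true  = refl
        ... | false = trans (sym (clause-false⇒φ-false w (bound φ) clause-false))
                            (trans (clause-false⇒evalB w φ clause-false) φ-true)

    complete : ∀ Γ φ → CL₁ Γ φ → L Γ φ
    complete Γ φ p with em {L Γ φ}
    ... | yes q = q
    ... | no ⊬φ = contradiction (lower p valuation valuation-true) valuation-false
      where open Completeness Γ φ ⊬φ

    L≋CL₁ : L ≋ CL₁
    L≋CL₁ Γ φ = mk⇔ (sound Γ φ) (complete Γ φ)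

  -- Classification by whether x is a theorem and whether Δ is empty

  classify : IsProtoalgebraic L → (L ≋ TRIV) ⊎ (L ≋ TRIV₋) ⊎ (L ≋ CL₁)
  classify (Δ , Δ-vars , ⊢Δ , Δ-mp) with em {L ∅ (var 0)}
  ... | yes p   = inj₁ (⊢var⇒TRIV p)
  ... | no ⊬var with em {Level.Lift (lsuc lzero) (∃ Δ)}
  -- With Δ empty, detachment reads x ⊢ y: any premise proves everything, while any theorem would
  -- make x a theorem.
  ...   | no Δ-empty = inj₂ (inj₁ λ Γ φ → mk⇔ nonempty (λ { (lift (γ , γ∈Γ)) →
            instantiate (λ { 0 → γ ; _ → φ }) Δ-mp
              λ { _ (inj₁ refl) → reflexive Γ γ γ∈Γ
                ; δ (inj₂ δ∈Δ)  → contradiction (lift (δ , δ∈Δ)) Δ-empty } }))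
    where
    ⊬ : ∀ φ → ¬ L ∅ φ
    ⊬ φ p = ⊬var (instantiate (λ { 0 → φ ; _ → var 0 }) Δ-mp
      λ { _ (inj₁ refl) → p
        ; δ (inj₂ δ∈Δ)  → contradiction (lift (δ , δ∈Δ)) Δ-empty })

    nonempty : ∀ {Γ φ} → L Γ φ → TRIV₋ Γ φ
    nonempty {Γ} {φ} p with em {TRIV₋ Γ φ}
    ... | yes q = q
    ... | no Γ-empty = contradiction
      (monotone Γ ∅ φ (λ γ γ∈Γ → contradiction (lift (γ , γ∈Γ)) Γ-empty) p) (⊬ φ)
  ...   | yes (lift (δ₀ , δ₀∈Δ)) = inj₂ (inj₂ (WithDetachment.L≋CL₁ ⊬var
            (⊑-mp (δ₀ [ yx ]) (excludedMiddle (var 0))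
              (collapse-⊑-excludedMiddle δ₀ (Δ-vars δ₀ δ₀∈Δ)) (⊢Δ δ₀ δ₀∈Δ)) detach))
    where
    ↔-⊑-Δ : ∀ δ → Δ δ → (var 0 ↔ᶠ var 1) ⊑ δ
    ↔-⊑-Δ δ δ∈Δ with evalB (λ _ → true) δ in δ-true | evalB (λ _ → false) δ in δ-false
    ... | true  | true  = ↔-⊑ δ (Δ-vars δ δ∈Δ) δ-true δ-false
    ... | true  | false =
      contradiction (⊑-mp (δ [ yx ]) (var 0)
        (collapse-⊑-var δ (Δ-vars δ δ∈Δ) δ-false) (⊢Δ δ δ∈Δ)) ⊬var
    -- Here ¬x would be a theorem; substituting ¬x for x gives ¬¬x, which has the same value as x.
    ... | false | _     = contradiction
      (⊑-mp (¬ᶠ (¬ᶠ (var 0))) (var 0)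
        (λ A v → DeMorganProperties.≤-reflexive A (DeMorganLattice.∼-involutive A (v 0)))
        (theorem-subst (¬ᶠ (var 0)) (λ n → ¬ᶠ (var n))
          (⊑-mp (δ [ yx ]) (¬ᶠ (var 0))
            (collapse-⊑-¬var δ (Δ-vars δ δ∈Δ) δ-true) (⊢Δ δ δ∈Δ))))
      ⊬var

    detach : ∀ {Γ} a b → L Γ a → L Γ (a ↔ᶠ b) → L Γ b
    detach a b p q = instantiate σ Δ-mp
      -- Each premise δ(a,b) follows from a ↔ b, since every δ in Δ lies above x ↔ y.
      λ { _ (inj₁ refl) → p
        ; δ (inj₂ δ∈Δ)  →
            instantiate σ (ext _ δ (⊑⇒BD∞ (var 0 ↔ᶠ var 1) δ (↔-⊑-Δ δ δ∈Δ))) λ { _ refl → q } }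
      where
      σ : Subst
      σ 0 = a
      σ _ = b

mainTheorem16 : ExcludedMiddle (lsuc lzero)
    → IsProtoExtBD∞ CL₁
    × (∀ (L : Rel⊢) → IsProtoExtBD∞ L → (L ≋ TRIV) ⊎ (L ≋ TRIV₋) ⊎ (L ≋ CL₁))
mainTheorem16 em =
  (CL₁-isLogic , CL₁-extends-BD∞ , CL₁-isProtoalgebraic) ,
  λ L (isLogic , ext , proto) → Extension.classify em L isLogic ext proto
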